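{- For any set $S$ of positive integers, the minimal $S$-universality criterion set is unique; that is, there is exactly one minimal $S$-universality criterion set.
   Context: A $\mathbb Z$-lattice is a free $\mathbb Z$-module $L$ of finite rank with a positive definite symmetric bilinear form $B:L\times L\to\mathbb Z$ (integral valued); $Q(x)=B(x,x)$. A positive integer $a$ (identified with the unary form $ax^2$) is represented by $L$ if $a=Q(x)$ for some $x\in L$. For a set $S$ of positive integers, a $\mathbb Z$-lattice (of any rank) is $S$-universal if it represents every element of $S$. A subset $S_0\subseteq S$ is an $S$-universality criterion set if every $S_0$-universal $\mathbb Z$-lattice is $S$-universal. It is minimal if no proper subset of $S_0$ is an $S$-universality criterion set. -}

module Defs where

open import Algebra.Module.Bundles using (Module)
open import Data.Fin.Base using (Fin)
open import Data.Integer.Base using (ℤ; +_; 0ℤ; _+_; _*_; _<_)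
open import Data.Integer.Properties using (+-*-commutativeRing)
open import Data.Nat.Base using (ℕ)
open import Data.Product.Base using (∃; _×_)
open import Data.Vec.Functional using (Vector)
open import Level using (0ℓ; suc)
open import Relation.Binary.PropositionalEquality.Core using (_≡_)
open import Relation.Nullary.Negation.Core using (¬_)
open import Relation.Unary using (Pred; _∈_; _⊆_; _⊂_)
import Algebra.Properties.CommutativeMonoid.Sum as Sum

ℤ-Module : Set (suc 0ℓ)
ℤ-Module = Module +-*-commutativeRing 0ℓ 0ℓ

module _ (M : ℤ-Module) where
  open Module M
  open Sum +ᴹ-commutativeMonoid using (sum)

  linearCombination : ∀ {n} → Vector ℤ n → Vector Carrierᴹ n → Carrierᴹ
  linearCombination c e = sum (λ i → c i *ₗ e i)

  record IsBasis {n : ℕ} (e : Vector Carrierᴹ n) : Set where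
    field
      spanning    : ∀ x → ∃ λ c → x ≈ᴹ linearCombination c e
      independent : ∀ c → linearCombination c e ≈ᴹ 0ᴹ → ∀ i → c i ≡ 0ℤ

  record IsFreeOfFiniteRank : Set where
    field
      rank    : ℕ
      basis   : Vector Carrierᴹ rank
      isBasis : IsBasis basis

  record IsBilinear (B : Carrierᴹ → Carrierᴹ → ℤ) : Set where
    field
      cong : ∀ {x x′ y y′} → x ≈ᴹ x′ → y ≈ᴹ y′ → B x y ≡ B x′ y′
      +-homoˡ : ∀ x x′ y → B (x +ᴹ x′) y ≡ B x y + B x′ y
      +-homoʳ : ∀ x y y′ → B x (y +ᴹ y′) ≡ B x y + B x y′
      *-homoˡ : ∀ k x y → B (k *ₗ x) y ≡ k * B x y
      *-homoʳ : ∀ k x y → B x (k *ₗ y) ≡ k * B x y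

record ℤ-Lattice : Set (suc 0ℓ) where
  field
    ℤ-module : ℤ-Module
  open Module ℤ-module public
  field
    isFreeOfFiniteRank : IsFreeOfFiniteRank ℤ-module
    B                  : Carrierᴹ → Carrierᴹ → ℤ
    isBilinear         : IsBilinear ℤ-module B
    symmetric          : ∀ x y → B x y ≡ B y x
    positiveDefinite   : ∀ x → ¬ (x ≈ᴹ 0ᴹ) → 0ℤ < B x x

  Q : Carrierᴹ → ℤ
  Q x = B x x

Represents : ℤ-Lattice → ℕ → Set
Represents L a = ∃ λ x → + a ≡ Q x
  where open ℤ-Lattice L

-- Sets of positive integers are predicates on ℕ; positivity of the
-- ambient set is imposed where that set is introduced.

Universal : Pred ℕ 0ℓ → ℤ-Lattice → Set
Universal S L = ∀ {a} → a ∈ S → Represents L a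

IsCriterionSet : Pred ℕ 0ℓ → Pred ℕ 0ℓ → Set (suc 0ℓ)
IsCriterionSet S S₀ = S₀ ⊆ S × (∀ L → Universal S₀ L → Universal S L)

IsMinimalCriterionSet : Pred ℕ 0ℓ → Pred ℕ 0ℓ → Set (suc 0ℓ)
IsMinimalCriterionSet S S₀ =
  IsCriterionSet S S₀ × (∀ T → T ⊂ S₀ → ¬ IsCriterionSet S T)

{-# OPTIONS --safe #-}

-- Call a ∈ S a truant if some lattice L represents every element of S below a,
-- but not a.  The truants are the only minimal criterion set.  They form a
-- criterion set: the least element of S missed by a lattice is a truant.  And
-- every criterion set contains each truant a: with L as above and c = a + 1,
--
--   L ⊥ ⟨c⟩ ⊥ ⟨c + 1⟩ ⊥ … ⊥ ⟨c + a⟩ ⊥ ⟨c⟩ ⊥ ⟨c⟩ ⊥ ⟨c⟩ ⊥ ⟨c⟩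
--
-- misses a, like L, since the new coefficients exceed a, but represents every
-- other element of S: write n > a as (c + r) + c q with r ≤ a, and q as a sum
-- of four squares.

module Submission where

open import Defs
open import Axiom.ExcludedMiddle using (ExcludedMiddle)
open import Data.Nat.Base using (ℕ; _<_)
open import Data.Product using (∃!)
open import Level using (0ℓ; suc)
open import Relation.Unary using (Pred; _⊆_; _≐_)

open import Algebra.Module.Bundles using (Module)
import Algebra.Module.Construct.DirectProduct as Product
import Algebra.Module.Construct.TensorUnit as Unit
open import Data.Fin.Base as Fin using (Fin; zero; toℕ; fromℕ<; splitAt; join)
import Data.Fin.Properties as Fin
open import Data.Integer.Base as ℤ
  using (ℤ; +_; 0ℤ; 1ℤ; +[1+_]; -[1+_]; +<+; _+_; _*_; _-_; -_; ∣_∣)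
open import Data.Integer.DivMod using (_%ℕ_; _/ℕ_; n%ℕd<d; a≡a%ℕn+[a/ℕn]*n)
open import Data.Integer.Divisibility.Signed as ℤ using (_∣_; divides)
import Data.Integer.Properties as ℤ
open import Data.Integer.Tactic.RingSolver using (solve-∀)
open import Data.List.Base using (List; []; _∷_; foldr; map; upTo)
open import Data.List.Membership.Propositional using () renaming (_∈_ to _∈ˡ_)
open import Data.List.Membership.Propositional.Properties using (∈-map⁺; ∈-map⁻; ∈-upTo⁺)
open import Data.List.Relation.Unary.All using (All; []; _∷_; tabulate)
open import Data.List.Relation.Unary.Any using (here; there)
open import Data.Nat.Base as ℕ using (_≤_; z<s; NonZero; ⌊_/2⌋)
import Data.Nat.Divisibility as ℕ
import Data.Nat.DivMod as ℕ
open import Data.Nat.Induction using (<-rec)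
open import Data.Nat.ListAction using (product)
open import Data.Nat.Primality
  using (Prime; euclidsLemma; prime⇒irreducible; prime⇒nonZero; prime⇒nonTrivial)
open import Data.Nat.Primality.Factorisation using (factorise; PrimeFactorisation)
import Data.Nat.Properties as ℕ
open import Data.Product.Base using (∃; ∃₂; _×_; _,_; proj₁; proj₂)
open import Data.Sum.Base using (_⊎_; inj₁; inj₂; [_,_]′)
open import Data.Vec.Functional using (Vector) renaming (_∷_ to _∷ᵛ_)
open import Function.Base using (_∘_; _$_; flip; id)
open import Level using (lift; lower)
open import Relation.Binary.Definitions using (tri<; tri≈; tri>)
open import Relation.Binary.PropositionalEquality
open import Relation.Nullary.Decidable
  using (yes; no; True; toWitness; fromWitness; map′; decidable-stable)
open import Relation.Nullary.Negation using (¬_; contradiction)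
open import Relation.Unary using (_∈_)

-- Lagrange's four-square theorem

ℤ⁴ : Set
ℤ⁴ = ℤ × ℤ × ℤ × ℤ

norm : ℤ⁴ → ℤ
norm (a , b , c , d) = a * a + b * b + c * c + d * d

IsNorm : ℤ → Set
IsNorm n = ∃ λ z → norm z ≡ n

_·_ : ℤ⁴ → ℤ⁴ → ℤ
(a , b , c , d) · (e , f , g , h) = a * e + b * f + c * g + d * h

i*i≡∣i∣*∣i∣ : ∀ i → i * i ≡ + (∣ i ∣ ℕ.* ∣ i ∣)
i*i≡∣i∣*∣i∣ (+ n)    = sym (ℤ.pos-* n n)
i*i≡∣i∣*∣i∣ -[1+ n ] = refl

0≤i*i : ∀ i → 0ℤ ℤ.≤ i * i
0≤i*i i = subst (0ℤ ℤ.≤_) (sym (i*i≡∣i∣*∣i∣ i)) (ℤ.+≤+ ℕ.z≤n)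

∣i∣<m⇒i*i<m*m : ∀ i {m} → ∣ i ∣ < m → i * i ℤ.< + m * + m
∣i∣<m⇒i*i<m*m i {m} i<m = subst₂ ℤ._<_ (sym (i*i≡∣i∣*∣i∣ i)) (ℤ.pos-* m m)
  (+<+ (ℕ.*-mono-< i<m i<m))

norm-nonNegative : ∀ z → 0ℤ ℤ.≤ norm z
norm-nonNegative (a , b , c , d) =
  ℤ.+-mono-≤ (ℤ.+-mono-≤ (ℤ.+-mono-≤ (0≤i*i a) (0≤i*i b)) (0≤i*i c)) (0≤i*i d)

-- Euler's four-square identity, as N(z′ z̄) = N(z) N(z′) for quaternions.
norm-* : ∀ {m n} → IsNorm m → IsNorm n → IsNorm (m * n)
norm-* ((a , b , c , d) , refl) ((e , f , g , h) , refl) =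
  ((a , b , c , d) · (e , f , g , h) ,
   a * f - b * e + (c * h - d * g) ,
   a * g - c * e + (d * f - b * h) ,
   a * h - d * e + (b * g - c * f)) ,
  euler a b c d e f g h
  where
  euler : ∀ a b c d e f g h →
    (a * e + b * f + c * g + d * h) * (a * e + b * f + c * g + d * h) +
    (a * f - b * e + (c * h - d * g)) * (a * f - b * e + (c * h - d * g)) +
    (a * g - c * e + (d * f - b * h)) * (a * g - c * e + (d * f - b * h)) +
    (a * h - d * e + (b * g - c * f)) * (a * h - d * e + (b * g - c * f)) ≡
    (a * a + b * b + c * c + d * d) * (e * e + f * f + g * g + h * h)
  euler = solve-∀

-- Residues of least absolute value

double² : ℤ → ℤ
double² y = (y * + 2) * (y * + 2)

-- This is `-m/2 < y ≤ m/2`, doubled to stay within the integers. The endpoint `y = m/2` is kept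
-- apart because it is the only case in which `double² y < m²` fails.
Centred : ℕ → ℤ → Set
Centred m y = y * + 2 ≡ + m ⊎ double² y ℤ.< + m * + m

centredResidue : ∀ m .{{_ : NonZero m}} x → ∃₂ λ y k → x ≡ y + + m * k × Centred m y
centredResidue m x with x %ℕ m | x /ℕ m | a≡a%ℕn+[a/ℕn]*n x m | n%ℕd<d x m
... | r | q | x≡ | r<m with ℕ.<-cmp (r ℕ.* 2) m
...   | tri< 2r<m _ _ = + r , q , trans x≡ (cong (ℤ._+_ (+ r)) (ℤ.*-comm q (+ m))) ,
  inj₂ (∣i∣<m⇒i*i<m*m (+ r * + 2) (subst (_< m) (sym (ℤ.abs-* (+ r) (+ 2))) 2r<m))
...   | tri≈ _ 2r≡m _ = + r , q , trans x≡ (cong (ℤ._+_ (+ r)) (ℤ.*-comm q (+ m))) ,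
  inj₁ (trans (sym (ℤ.pos-* r 2)) (cong +_ 2r≡m))
-- With `s = m - r`, the residue `r - m = - s` replaces `r` and the quotient grows by one.
...   | tri> _ _ m<2r with s , refl ← ℕ.m≤n⇒∃[o]m+o≡n (ℕ.<⇒≤ r<m) =
  - + s , q + 1ℤ ,
  trans x≡ (trans (cong (λ t → + r + q * t) (ℤ.pos-+ r s)) (trans (shift (+ r) (+ s) q)
    (cong (λ t → - + s + t * (q + 1ℤ)) (sym (ℤ.pos-+ r s))))) ,
  inj₂ (∣i∣<m⇒i*i<m*m (- + s * + 2) (subst (_< r ℕ.+ s)
    (sym (trans (ℤ.abs-* (- + s) (+ 2)) (cong (ℕ._* 2) (ℤ.∣-i∣≡∣i∣ (+ s))))) 2s<r+s))
  where
  shift : ∀ r s q → r + q * (r + s) ≡ - s + (r + s) * (q + 1ℤ)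
  shift = solve-∀

  double : ∀ n → n ℕ.* 2 ≡ n ℕ.+ n
  double n = trans (ℕ.*-comm n 2) (cong (n ℕ.+_) (ℕ.+-identityʳ n))

  2s<r+s : s ℕ.* 2 < r ℕ.+ s
  2s<r+s = subst (_< r ℕ.+ s) (sym (double s))
    (ℕ.+-monoˡ-< s (ℕ.+-cancelˡ-< r s r (subst (r ℕ.+ s <_) (double r) m<2r)))

i+j≡0⇒i≡0×j≡0 : ∀ {i j} → 0ℤ ℤ.≤ i → 0ℤ ℤ.≤ j → i + j ≡ 0ℤ → i ≡ 0ℤ × j ≡ 0ℤ
i+j≡0⇒i≡0×j≡0 {+ m} {+ n} _ _ eq = cong +_ (ℕ.m+n≡0⇒m≡0 m eq′) , cong +_ (ℕ.m+n≡0⇒n≡0 m eq′)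
  where eq′ = ℤ.+-injective eq

i*i≡0⇒i≡0 : ∀ {i} → i * i ≡ 0ℤ → i ≡ 0ℤ
i*i≡0⇒i≡0 {i} eq = [ id , id ]′ (ℤ.i*j≡0⇒i≡0∨j≡0 i eq)

-- Nonnegative summands with sum zero all vanish, so `z` has only zero coordinates.
norm≡0⇒· : ∀ z → norm z ≡ 0ℤ → ∀ w → w · z ≡ 0ℤ
norm≡0⇒· (a , b , c , d) eq (e , f , g , h)
  with abc , d² ← i+j≡0⇒i≡0×j≡0 (ℤ.+-mono-≤ (ℤ.+-mono-≤ (0≤i*i a) (0≤i*i b)) (0≤i*i c)) (0≤i*i d) eq
  with ab , c² ← i+j≡0⇒i≡0×j≡0 (ℤ.+-mono-≤ (0≤i*i a) (0≤i*i b)) (0≤i*i c) abc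
  with a² , b² ← i+j≡0⇒i≡0×j≡0 (0≤i*i a) (0≤i*i b) ab
  rewrite i*i≡0⇒i≡0 {a} a² | i*i≡0⇒i≡0 {b} b² | i*i≡0⇒i≡0 {c} c² | i*i≡0⇒i≡0 {d} d² = zeros e f g h
  where
  zeros : ∀ e f g h → e * 0ℤ + f * 0ℤ + g * 0ℤ + h * 0ℤ ≡ 0ℤ
  zeros = solve-∀

Centred⁴ : ℕ → ℤ⁴ → Set
Centred⁴ m (a , b , c , d) = Centred m a × Centred m b × Centred m c × Centred m d

AllHalf : ℕ → ℤ⁴ → Set
AllHalf m (a , b , c , d) = a * + 2 ≡ + m × b * + 2 ≡ + m × c * + 2 ≡ + m × d * + 2 ≡ + m

norm*4 : ∀ a b c d → double² a + double² b + double² c + double² d ≡ norm (a , b , c , d) * + 4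
norm*4 = identity
  where
  identity : ∀ a b c d →
    (a * + 2) * (a * + 2) + (b * + 2) * (b * + 2) + (c * + 2) * (c * + 2) + (d * + 2) * (d * + 2) ≡
    (a * a + b * b + c * c + d * d) * + 4
  identity = solve-∀

4*square : ∀ m → m * m + m * m + m * m + m * m ≡ m * m * + 4
4*square = solve-∀

centred-≤ : ∀ {m} y → Centred m y → double² y ℤ.≤ + m * + m
centred-≤ y (inj₁ eq) = ℤ.≤-reflexive (cong₂ _*_ eq eq)
centred-≤ y (inj₂ lt) = ℤ.<⇒≤ lt

-- Summing `(2yᵢ)² ≤ m²` over the four coordinates bounds `4 norm z` by `4m²`. A single strict
-- coordinate makes the sum strict, so equality needs every coordinate to be `m/2`.
centred-norm : ∀ {m} z → Centred⁴ m z → AllHalf m z ⊎ norm z ℤ.< + m * + m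
centred-norm {m} (a , b , c , d) = go
  where
  cancel : double² a + double² b + double² c + double² d ℤ.<
             + m * + m + + m * + m + + m * + m + + m * + m →
           norm (a , b , c , d) ℤ.< + m * + m
  cancel lt = ℤ.*-cancelʳ-<-nonNeg (+ 4) (subst₂ ℤ._<_ (norm*4 a b c d) (4*square (+ m)) lt)

  go : Centred⁴ m (a , b , c , d) → _
  go (inj₁ a≡ , inj₁ b≡ , inj₁ c≡ , inj₁ d≡) = inj₁ (a≡ , b≡ , c≡ , d≡)
  go (inj₂ a< , b≤ , c≤ , d≤) = inj₂ $ cancel $
    ℤ.+-mono-<-≤ (ℤ.+-mono-<-≤ (ℤ.+-mono-<-≤ a< (centred-≤ b b≤)) (centred-≤ c c≤)) (centred-≤ d d≤)
  go (a≤ , inj₂ b< , c≤ , d≤) = inj₂ $ cancel $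
    ℤ.+-mono-<-≤ (ℤ.+-mono-<-≤ (ℤ.+-mono-≤-< (centred-≤ a a≤) b<) (centred-≤ c c≤)) (centred-≤ d d≤)
  go (a≤ , b≤ , inj₂ c< , d≤) = inj₂ $ cancel $
    ℤ.+-mono-<-≤ (ℤ.+-mono-≤-< (ℤ.+-mono-≤ (centred-≤ a a≤) (centred-≤ b b≤)) c<) (centred-≤ d d≤)
  go (a≤ , b≤ , c≤ , inj₂ d<) = inj₂ $ cancel $
    ℤ.+-mono-≤-< (ℤ.+-mono-≤ (ℤ.+-mono-≤ (centred-≤ a a≤) (centred-≤ b b≤)) (centred-≤ c c≤)) d<

-- Descent on the multiplier of p

quotient-bounds : ∀ m .{{_ : NonZero m}} r {n} → 0ℤ ℤ.≤ n → n ≡ + m * r → n ℤ.< + m * + m →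
                  r ≡ 0ℤ ⊎ (∃ λ r′ → 0 < r′ × r′ < m × r ≡ + r′)
quotient-bounds _ (+ ℕ.zero) _ _ _ = inj₁ refl
quotient-bounds m +[1+ n ] _ refl lt =
  inj₂ (ℕ.suc n , z<s , ℤ.drop‿+<+ (ℤ.*-cancelˡ-<-nonNeg (+ m) lt) , refl)
quotient-bounds (ℕ.suc _) -[1+ _ ] () refl _

-- Reduce the quaternion `x` of norm `m p` to its centred residue `y` modulo `m`, of norm `m r` with
-- `r ≤ m`. Then `y x̄` has norm `m² r p` and is divisible by `m`, and the quotient has norm `r p`.
-- The extreme values `r = 0` and `r = m` would make `m` divide `p`.
descent : ∀ {m p} .{{_ : NonZero m}} → ¬ (+ m ∣ + p) → IsNorm (+ m * + p) →
          ∃ λ r → 0 < r × r < m × IsNorm (+ r * + p)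
descent {m} {p} m∤p ((x₁ , x₂ , x₃ , x₄) , norm-x)
  with y₁ , k₁ , refl , y₁-centred ← centredResidue m x₁
  with y₂ , k₂ , refl , y₂-centred ← centredResidue m x₂
  with y₃ , k₃ , refl , y₃-centred ← centredResidue m x₃
  with y₄ , k₄ , refl , y₄-centred ← centredResidue m x₄ =
  conclude (centred-norm y (y₁-centred , y₂-centred , y₃-centred , y₄-centred))
  where
  y k : ℤ⁴
  y = y₁ , y₂ , y₃ , y₄
  k = k₁ , k₂ , k₃ , k₄

  -- As `x = y + m k`, expanding gives `norm x = norm y + m t`, so `norm x = m p` leaves
  -- `norm y = m (p - t)`.
  t r : ℤ
  t = k · y + k · y + + m * norm k
  r = + p - t

  norm-y : norm y ≡ + m * r
  norm-y = trans (expand (+ m) y₁ y₂ y₃ y₄ k₁ k₂ k₃ k₄)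
    (trans (cong (_- + m * t) norm-x) (factor (+ m) (+ p) t))
    where
    expand : ∀ m y₁ y₂ y₃ y₄ k₁ k₂ k₃ k₄ →
      y₁ * y₁ + y₂ * y₂ + y₃ * y₃ + y₄ * y₄ ≡
      (y₁ + m * k₁) * (y₁ + m * k₁) + (y₂ + m * k₂) * (y₂ + m * k₂) +
      (y₃ + m * k₃) * (y₃ + m * k₃) + (y₄ + m * k₄) * (y₄ + m * k₄) -
      m * ((k₁ * y₁ + k₂ * y₂ + k₃ * y₃ + k₄ * y₄) + (k₁ * y₁ + k₂ * y₂ + k₃ * y₃ + k₄ * y₄) +
           m * (k₁ * k₁ + k₂ * k₂ + k₃ * k₃ + k₄ * k₄))
    expand = solve-∀

    factor : ∀ m p t → m * p - m * t ≡ m * (p - t)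
    factor = solve-∀

  p≡r+t : + p ≡ r + t
  p≡r+t = cancel (+ p) t
    where
    cancel : ∀ p t → p ≡ p - t + t
    cancel = solve-∀

  -- As quaternions, w = r + y k̄ = y x̄ / m.
  w : ℤ⁴
  w = r + k · y ,
      k₁ * y₂ - k₂ * y₁ + (k₃ * y₄ - k₄ * y₃) ,
      k₁ * y₃ - k₃ * y₁ + (k₄ * y₂ - k₂ * y₄) ,
      k₁ * y₄ - k₄ * y₁ + (k₂ * y₃ - k₃ * y₂)

  -- The norm expands to `r² + 2r (k · y) + norm k * norm y`. Substituting `norm y = m r` takes out
  -- a factor `r`, and the cofactor is `r + t = p`.
  norm-w : norm w ≡ r * + p
  norm-w = trans (expand r y₁ y₂ y₃ y₄ k₁ k₂ k₃ k₄)
    (trans (cong (λ n → r * r + r * (k · y + k · y) + norm k * n) norm-y)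
    (trans (factor r (k · y + k · y) (norm k) (+ m)) (cong (r *_) (sym p≡r+t))))
    where
    expand : ∀ r y₁ y₂ y₃ y₄ k₁ k₂ k₃ k₄ →
      (r + (k₁ * y₁ + k₂ * y₂ + k₃ * y₃ + k₄ * y₄)) * (r + (k₁ * y₁ + k₂ * y₂ + k₃ * y₃ + k₄ * y₄)) +
      (k₁ * y₂ - k₂ * y₁ + (k₃ * y₄ - k₄ * y₃)) * (k₁ * y₂ - k₂ * y₁ + (k₃ * y₄ - k₄ * y₃)) +
      (k₁ * y₃ - k₃ * y₁ + (k₄ * y₂ - k₂ * y₄)) * (k₁ * y₃ - k₃ * y₁ + (k₄ * y₂ - k₂ * y₄)) +
      (k₁ * y₄ - k₄ * y₁ + (k₂ * y₃ - k₃ * y₂)) * (k₁ * y₄ - k₄ * y₁ + (k₂ * y₃ - k₃ * y₂)) ≡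
      r * r + r * ((k₁ * y₁ + k₂ * y₂ + k₃ * y₃ + k₄ * y₄) + (k₁ * y₁ + k₂ * y₂ + k₃ * y₃ + k₄ * y₄)) +
      (k₁ * k₁ + k₂ * k₂ + k₃ * k₃ + k₄ * k₄) * (y₁ * y₁ + y₂ * y₂ + y₃ * y₃ + y₄ * y₄)
    expand = solve-∀

    factor : ∀ r s n m → r * r + r * s + n * (m * r) ≡ r * (r + (s + m * n))
    factor = solve-∀

  -- In `p = r + 2 (k · y) + m * norm k` the last term is a multiple of `m`, so `m` cannot divide
  -- both others.
  m∣2k·y⇒m∤r : + m ∣ (k · y + k · y) → ¬ (+ m ∣ r)
  m∣2k·y⇒m∤r m∣2k·y m∣r = m∤p (subst (+ m ∣_) (sym p≡r+t)
    (ℤ.∣m∣n⇒∣m+n m∣r (ℤ.∣m∣n⇒∣m+n m∣2k·y (divides (norm k) (ℤ.*-comm (+ m) (norm k))))))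

  -- If r = 0 or all 2yᵢ = m, then m divides p.
  conclude : AllHalf m y ⊎ norm y ℤ.< + m * + m → ∃ λ r → 0 < r × r < m × IsNorm (+ r * + p)
  conclude (inj₂ small) = [ zero-case , positive-case ]′
    (quotient-bounds m r (norm-nonNegative y) norm-y small)
    where
    m∣0 : + m ∣ 0ℤ
    m∣0 = divides 0ℤ refl

    zero-case : r ≡ 0ℤ → ∃ λ r → 0 < r × r < m × IsNorm (+ r * + p)
    zero-case r≡0 = contradiction (subst (+ m ∣_) (sym r≡0) m∣0)
      (m∣2k·y⇒m∤r (subst (+ m ∣_) (sym (cong₂ _+_ k·y≡0 k·y≡0)) m∣0))
      where
      k·y≡0 : k · y ≡ 0ℤ
      k·y≡0 = norm≡0⇒· y (trans norm-y (trans (cong (+ m *_) r≡0) (ℤ.*-zeroʳ (+ m)))) k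

    positive-case : (∃ λ r′ → 0 < r′ × r′ < m × r ≡ + r′) →
                    ∃ λ r → 0 < r × r < m × IsNorm (+ r * + p)
    positive-case (r′ , 0<r′ , r′<m , r≡r′) = r′ , 0<r′ , r′<m , w , trans norm-w (cong (_* + p) r≡r′)
  conclude (inj₁ (e₁ , e₂ , e₃ , e₄)) = contradiction m∣r (m∣2k·y⇒m∤r m∣2k·y)
    where
    halves : ∀ k₁ k₂ k₃ k₄ y₁ y₂ y₃ y₄ →
      (k₁ * y₁ + k₂ * y₂ + k₃ * y₃ + k₄ * y₄) + (k₁ * y₁ + k₂ * y₂ + k₃ * y₃ + k₄ * y₄) ≡
      k₁ * (y₁ * + 2) + k₂ * (y₂ * + 2) + k₃ * (y₃ * + 2) + k₄ * (y₄ * + 2)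
    halves = solve-∀

    m∣k*2y : ∀ k y → y * + 2 ≡ + m → + m ∣ k * (y * + 2)
    m∣k*2y k _ e = divides k (cong (k *_) e)

    m∣2k·y : + m ∣ k · y + k · y
    m∣2k·y = subst (+ m ∣_) (sym (halves k₁ k₂ k₃ k₄ y₁ y₂ y₃ y₄))
      (ℤ.∣m∣n⇒∣m+n (ℤ.∣m∣n⇒∣m+n (ℤ.∣m∣n⇒∣m+n (m∣k*2y k₁ y₁ e₁) (m∣k*2y k₂ y₂ e₂))
        (m∣k*2y k₃ y₃ e₃)) (m∣k*2y k₄ y₄ e₄))

    sum-double² : double² y₁ + double² y₂ + double² y₃ + double² y₄ ≡
                  + m * + m + + m * + m + + m * + m + + m * + m
    sum-double² rewrite e₁ | e₂ | e₃ | e₄ = refl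

    -- If every `2yᵢ` is `m`, then `4 norm y = 4m²`. Hence `m r = m²`.
    r≡m : r ≡ + m
    r≡m = ℤ.*-cancelˡ-≡ (+ m) r (+ m) (trans (sym norm-y)
      (ℤ.*-cancelʳ-≡ (norm y) (+ m * + m) (+ 4)
        (trans (sym (norm*4 y₁ y₂ y₃ y₄)) (trans sum-double² (4*square (+ m))))))

    m∣r : + m ∣ r
    m∣r = divides 1ℤ (trans r≡m (sym (ℤ.*-identityˡ (+ m))))

-- A small multiple of a prime as a sum of squares

∣i-j⇒∣j-i : ∀ {k} i j → k ∣ i - j → k ∣ j - i
∣i-j⇒∣j-i {k} i j k∣i-j = subst (k ∣_) (swap i j) (ℤ.∣m⇒∣-m k∣i-j)
  where
  swap : ∀ i j → - (i - j) ≡ j - i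
  swap = solve-∀

module _ {p : ℕ} (p-prime : Prime p) where

  private
    instance
      p-nonZero : NonZero p
      p-nonZero = prime⇒nonZero p-prime

    1<p : 1 < p
    1<p = ℕ.nonTrivial⇒n>1 p {{prime⇒nonTrivial p-prime}}

    -- Rounding down gives `2h ≤ p < 2(h + 1)` for `p = 2` as well as for odd `p`, so parity calls
    -- for no case split.
    h : ℕ
    h = ⌊ p /2⌋

    2h≤p : h ℕ.+ h ≤ p
    2h≤p = subst (h ℕ.+ h ≤_) (ℕ.⌊n/2⌋+⌈n/2⌉≡n p) (ℕ.+-monoʳ-≤ h (ℕ.⌊n/2⌋≤⌈n/2⌉ p))

    p<2[1+h] : p < ℕ.suc h ℕ.+ ℕ.suc h
    p<2[1+h] = ℕ.s≤s (subst (_≤ h ℕ.+ ℕ.suc h) (ℕ.⌊n/2⌋+⌈n/2⌉≡n p)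
      (ℕ.+-monoʳ-≤ h (ℕ.⌊n/2⌋-mono (ℕ.n≤1+n (ℕ.suc p)))))

    h<p : h < p
    h<p = subst (λ n → ⌊ n /2⌋ < n) (ℕ.suc-pred p) (ℕ.⌊n/2⌋<n (ℕ.pred p))

  %ℕ-≡⇒∣ : ∀ i j → i %ℕ p ≡ j %ℕ p → + p ∣ i - j
  %ℕ-≡⇒∣ i j eq = divides (i /ℕ p - j /ℕ p) (trans
    (cong₂ _-_ (a≡a%ℕn+[a/ℕn]*n i p) (trans (a≡a%ℕn+[a/ℕn]*n j p)
      (cong (λ r → + r + j /ℕ p * + p) (sym eq))))
    (cancel (+ (i %ℕ p)) (i /ℕ p) (j /ℕ p) (+ p)))
    where
    cancel : ∀ r q q′ p → r + q * p - (r + q′ * p) ≡ (q - q′) * p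
    cancel = solve-∀

  -- With `d = y - x`, the difference factors as `d (d + 2x)`. Both factors are positive and below
  -- `p`, the second because `d + 2x = x + y < 2y ≤ 2h ≤ p`. Euclid's lemma then rules out
  -- divisibility.
  square-difference : ∀ {x y} → x < y → y ≤ h → ¬ (+ p ∣ + y * + y - + x * + x)
  square-difference {x} {y} x<y y≤h p∣ with ℕ.m≤n⇒∃[o]m+o≡n (ℕ.<⇒≤ x<y)
  ... | ℕ.zero , refl = ℕ.<-irrefl (sym (ℕ.+-identityʳ x)) x<y
  ... | d@(ℕ.suc _) , refl = [ ℕ.>⇒∤ d<p , ℕ.>⇒∤ d+2x<p ]′
      (euclidsLemma d (d ℕ.+ (x ℕ.+ x)) p-prime (ℤ.∣⇒∣ᵤ (subst (+ p ∣_) factor p∣)))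
    where
    difference : ∀ x d → (x + d) * (x + d) - x * x ≡ d * (d + (x + x))
    difference = solve-∀

    factor : + (x ℕ.+ d) * + (x ℕ.+ d) - + x * + x ≡ + (d ℕ.* (d ℕ.+ (x ℕ.+ x)))
    factor = trans (difference (+ x) (+ d)) (sym (ℤ.pos-* d (d ℕ.+ (x ℕ.+ x))))

    d<p : d < p
    d<p = ℕ.≤-<-trans (ℕ.≤-trans (ℕ.m≤n+m d x) y≤h) h<p

    d+2x<p : d ℕ.+ (x ℕ.+ x) < p
    d+2x<p = ℕ.<-≤-trans (subst (_< x ℕ.+ d ℕ.+ (x ℕ.+ d))
      (trans (sym (ℕ.+-assoc x x d)) (ℕ.+-comm (x ℕ.+ x) d)) (ℕ.+-monoˡ-< (x ℕ.+ d) x<y))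
      (ℕ.≤-trans (ℕ.+-mono-≤ y≤h y≤h) 2h≤p)

  square-injective : ∀ {x y} → x ≤ h → y ≤ h → + p ∣ + x * + x - + y * + y → x ≡ y
  square-injective {x} {y} x≤h y≤h p∣ with ℕ.<-cmp x y
  ... | tri≈ _ x≡y _ = x≡y
  ... | tri> _ _ y<x = contradiction p∣ (square-difference y<x x≤h)
  ... | tri< x<y _ _ =
    contradiction (∣i-j⇒∣j-i (+ x * + x) (+ y * + y) p∣) (square-difference x<y y≤h)

  -- The h + 1 squares x² and the h + 1 numbers -(1 + y²), with 0 ≤ x, y ≤ h,
  -- are too many to be distinct modulo p.
  private
    value : Fin (ℕ.suc h) ⊎ Fin (ℕ.suc h) → ℤ
    value (inj₁ x) = + toℕ x * + toℕ x
    value (inj₂ y) = - (1ℤ + + toℕ y * + toℕ y)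

  1+x²+y² : ∃₂ λ x y → x ≤ h × y ≤ h × + p ∣ 1ℤ + + x * + x + + y * + y
  1+x²+y² =
    let i , j , i<j , eq = Fin.pigeonhole p<2[1+h] residue in
    go (split i) (split j) (λ e → Fin.<-irrefl (split-injective e) i<j)
      (%ℕ-≡⇒∣ (value (split i)) (value (split j)) (Fin.fromℕ<-injective _ _ _ _ eq))
    where
    split : Fin (ℕ.suc h ℕ.+ ℕ.suc h) → Fin (ℕ.suc h) ⊎ Fin (ℕ.suc h)
    split = splitAt (ℕ.suc h)

    split-injective : ∀ {i j} → split i ≡ split j → i ≡ j
    split-injective {i} {j} eq = trans (sym (Fin.join-splitAt (ℕ.suc h) (ℕ.suc h) i))
      (trans (cong (join (ℕ.suc h) (ℕ.suc h)) eq) (Fin.join-splitAt (ℕ.suc h) (ℕ.suc h) j))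

    residue : Fin (ℕ.suc h ℕ.+ ℕ.suc h) → Fin p
    residue i = fromℕ< (n%ℕd<d (value (split i)) p)

    toℕ≤h : ∀ (x : Fin (ℕ.suc h)) → toℕ x ≤ h
    toℕ≤h = ℕ.s≤s⁻¹ ∘ Fin.toℕ<n

    mixed : ∀ a b → + p ∣ a - - (1ℤ + b) → + p ∣ 1ℤ + a + b
    mixed a b = subst (+ p ∣_) (rearrange a b)
      where
      rearrange : ∀ a b → a - - (1ℤ + b) ≡ 1ℤ + a + b
      rearrange = solve-∀

    negated : ∀ a b → + p ∣ - (1ℤ + a) - - (1ℤ + b) → + p ∣ b - a
    negated a b = subst (+ p ∣_) (rearrange a b)
      where
      rearrange : ∀ a b → - (1ℤ + a) - - (1ℤ + b) ≡ b - a
      rearrange = solve-∀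

    toℕ² : Fin (ℕ.suc h) → ℤ
    toℕ² x = + toℕ x * + toℕ x

    -- A coincidence within one family contradicts `square-injective`. One across the families reads
    -- `x² ≡ -(1 + y²)` modulo `p`.
    go : ∀ u v → u ≢ v → + p ∣ value u - value v →
         ∃₂ λ x y → x ≤ h × y ≤ h × + p ∣ 1ℤ + + x * + x + + y * + y
    go (inj₁ x) (inj₁ y) u≢v p∣ =
      contradiction (cong inj₁ (Fin.toℕ-injective (square-injective (toℕ≤h x) (toℕ≤h y) p∣))) u≢v
    go (inj₁ x) (inj₂ y) _   p∣ = toℕ x , toℕ y , toℕ≤h x , toℕ≤h y , mixed (toℕ² x) (toℕ² y) p∣
    go (inj₂ y) (inj₁ x) _   p∣ = toℕ x , toℕ y , toℕ≤h x , toℕ≤h y ,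
      mixed (toℕ² x) (toℕ² y) (∣i-j⇒∣j-i (- (1ℤ + toℕ² y)) (toℕ² x) p∣)
    go (inj₂ x) (inj₂ y) u≢v p∣ = contradiction (cong inj₂ (Fin.toℕ-injective (sym
      (square-injective (toℕ≤h y) (toℕ≤h x) (negated (toℕ² x) (toℕ² y) p∣))))) u≢v

  -- The starting point of the descent: `1² + x² + y² + 0²` is a multiple `m p`, and `x , y ≤ h`
  -- keeps it below `p²`, so `m < p`.
  multiple-isNorm : ∃ λ m → 0 < m × m < p × IsNorm (+ m * + p)
  multiple-isNorm = let x , y , x≤h , y≤h , p∣ = 1+x²+y² in
    go x≤h y≤h (ℤ.∣⇒∣ᵤ (subst (+ p ∣_) (cast x y) p∣))
    where
    positive : ∀ m {n} → ℕ.suc n ≡ m ℕ.* p → 0 < m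
    positive (ℕ.suc _) _ = z<s

    norm-1xy0 : ∀ x y → norm (1ℤ , x , y , 0ℤ) ≡ 1ℤ + x * x + y * y
    norm-1xy0 x y = ℤ.+-identityʳ (1ℤ + x * x + y * y)

    cast : ∀ x y → 1ℤ + + x * + x + + y * + y ≡ + (1 ℕ.+ (x ℕ.* x ℕ.+ y ℕ.* y))
    cast x y = trans (ℤ.+-assoc 1ℤ (+ x * + x) (+ y * + y))
      (cong₂ (λ a b → 1ℤ + (a + b)) (sym (ℤ.pos-* x x)) (sym (ℤ.pos-* y y)))

    1+x²+y²<p² : ∀ {x y} → x ≤ h → y ≤ h → 1 ℕ.+ (x ℕ.* x ℕ.+ y ℕ.* y) < p ℕ.* p
    1+x²+y²<p² {x} {y} x≤h y≤h = begin-strict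
      1 ℕ.+ (x ℕ.* x ℕ.+ y ℕ.* y) ≤⟨ ℕ.s≤s (ℕ.+-mono-≤ (ℕ.*-mono-≤ x≤h x≤h) (ℕ.*-mono-≤ y≤h y≤h)) ⟩
      1 ℕ.+ (h ℕ.* h ℕ.+ h ℕ.* h) ≡⟨ cong (1 ℕ.+_) (ℕ.*-distribˡ-+ h h h) ⟨
      1 ℕ.+ h ℕ.* (h ℕ.+ h)       ≤⟨ ℕ.+-monoʳ-≤ 1 (ℕ.*-monoʳ-≤ h 2h≤p) ⟩
      1 ℕ.+ h ℕ.* p               <⟨ ℕ.+-monoˡ-< (h ℕ.* p) 1<p ⟩
      ℕ.suc h ℕ.* p               ≤⟨ ℕ.*-monoˡ-≤ p h<p ⟩
      p ℕ.* p                     ∎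
      where open ℕ.≤-Reasoning

    go : ∀ {x y} → x ≤ h → y ≤ h → p ℕ.∣ 1 ℕ.+ (x ℕ.* x ℕ.+ y ℕ.* y) →
         ∃ λ m → 0 < m × m < p × IsNorm (+ m * + p)
    go {x} {y} x≤h y≤h (ℕ.divides m eq) = m , positive m eq ,
      ℕ.*-cancelʳ-< p m p (subst (_< p ℕ.* p) eq (1+x²+y²<p² x≤h y≤h)) ,
      (1ℤ , + x , + y , 0ℤ) ,
      trans (norm-1xy0 (+ x) (+ y)) (trans (cast x y) (trans (cong +_ eq) (ℤ.pos-* m p)))

  -- From primes to all natural numbers

  ∤p : ∀ {m} → 1 < m → m < p → ¬ (+ m ∣ + p)
  ∤p 1<m m<p m∣p = [ ℕ.<⇒≢ 1<m ∘ sym , ℕ.<⇒≢ m<p ]′ (prime⇒irreducible p-prime (ℤ.∣⇒∣ᵤ m∣p))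

  -- While `1 < m < p`, primality gives the non-divisibility that `descent` asks for, so the
  -- multiplier shrinks until it is 1.
  prime-isNorm : IsNorm (+ p)
  prime-isNorm = let m , 0<m , m<p , mp-isNorm = multiple-isNorm in
    <-rec (λ m → 0 < m → m < p → IsNorm (+ m * + p) → IsNorm (+ p)) step m 0<m m<p mp-isNorm
    where
    step : ∀ m → (∀ {r} → r < m → 0 < r → r < p → IsNorm (+ r * + p) → IsNorm (+ p)) →
           0 < m → m < p → IsNorm (+ m * + p) → IsNorm (+ p)
    step 1 _ _ _ = subst IsNorm (ℤ.*-identityˡ (+ p))
    step m@(ℕ.suc (ℕ.suc _)) rec _ m<p mp-isNorm =
      let r , 0<r , r<m , rp-isNorm = descent (∤p (ℕ.s<s z<s) m<p) mp-isNorm in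
      rec r<m 0<r (ℕ.<-trans r<m m<p) rp-isNorm

product-isNorm : ∀ {ps} → All Prime ps → IsNorm (+ product ps)
product-isNorm []                       = (1ℤ , 0ℤ , 0ℤ , 0ℤ) , refl
product-isNorm {p ∷ ps} (p-prime ∷ ps-prime) =
  subst IsNorm (sym (ℤ.pos-* p (product ps)))
    (norm-* (prime-isNorm p-prime) (product-isNorm ps-prime))

lagrange : ∀ n → IsNorm (+ n)
lagrange ℕ.zero      = (0ℤ , 0ℤ , 0ℤ , 0ℤ) , refl
lagrange n@(ℕ.suc _) = subst (IsNorm ∘ +_) (sym isFactorisation) (product-isNorm factorsPrime)
  where open PrimeFactorisation (factorise n)

-- Orthogonal sums with unary lattices

x+d*0≡x : ∀ x d → x + d * 0ℤ ≡ x
x+d*0≡x = solve-∀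

module _ (L : ℤ-Lattice) where
  open ℤ-Lattice L
  open IsBilinear isBilinear using (*-homoˡ) renaming (cong to B-cong)

  Q-zero : Q 0ᴹ ≡ 0ℤ
  Q-zero = trans (B-cong (≈ᴹ-sym (*ₗ-zeroˡ 0ᴹ)) ≈ᴹ-refl) (*-homoˡ 0ℤ 0ᴹ 0ᴹ)

  -- Equality with zero need not be decidable in the module. No decision is made: `Q x < 0` already
  -- forces `x` to be nonzero, and positive definiteness then contradicts it.
  Q-nonNegative : ∀ x → 0ℤ ℤ.≤ Q x
  Q-nonNegative x = ℤ.≮⇒≥ λ Qx<0 → ℤ.<-asym Qx<0 $ positiveDefinite x λ x≈0 →
    ℤ.<-irrefl (trans (B-cong x≈0 x≈0) Q-zero) Qx<0

  represents-zero : Represents L 0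
  represents-zero = 0ᴹ , sym Q-zero

-- L ⊥ ⟨1 + d⟩
module Adjoin (L : ℤ-Lattice) (d : ℕ) where
  open ℤ-Lattice L using (ℤ-module; isFreeOfFiniteRank)
  private
    module L = ℤ-Lattice L
    module B = IsBilinear L.isBilinear

  M : ℤ-Module
  M = Product.⟨module⟩ ℤ-module Unit.⟨module⟩

  open Module M

  B : Carrierᴹ → Carrierᴹ → ℤ
  B (x , z) (y , w) = L.B x y + +[1+ d ] * (z * w)

  linearCombination-inject : ∀ {n} (c : Vector ℤ n) (e : Vector L.Carrierᴹ n) →
    linearCombination M c (λ i → e i , 0ℤ) ≈ᴹ (linearCombination ℤ-module c e , 0ℤ)
  linearCombination-inject {ℕ.zero} c e = ≈ᴹ-refl
  linearCombination-inject {ℕ.suc n} c e =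
    L.+ᴹ-congˡ (proj₁ ih) , cong₂ _+_ (ℤ.*-zeroʳ (c zero)) (proj₂ ih)
    where ih = linearCombination-inject (c ∘ Fin.suc) (e ∘ Fin.suc)

  module _ {n} (e : Vector L.Carrierᴹ n) where

    adjoinBasis : Vector Carrierᴹ (ℕ.suc n)
    adjoinBasis = (L.0ᴹ , 1ℤ) ∷ᵛ λ i → e i , 0ℤ

    linearCombination-adjoin : ∀ c → linearCombination M c adjoinBasis ≈ᴹ
                               (linearCombination ℤ-module (c ∘ Fin.suc) e , c zero)
    linearCombination-adjoin c =
      L.≈ᴹ-trans (L.+ᴹ-cong (L.*ₗ-zeroʳ (c zero)) (proj₁ tail≈)) (L.+ᴹ-identityˡ _) ,
      trans (cong₂ _+_ (ℤ.*-identityʳ (c zero)) (proj₂ tail≈)) (ℤ.+-identityʳ (c zero))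
      where tail≈ = linearCombination-inject (c ∘ Fin.suc) e

    adjoinBasis-isBasis : IsBasis ℤ-module e → IsBasis M adjoinBasis
    adjoinBasis-isBasis isBasis = record
      { spanning = λ (x , z) → let c , x≈ = spanning x in
          (z ∷ᵛ c) , ≈ᴹ-trans (x≈ , refl) (≈ᴹ-sym (linearCombination-adjoin (z ∷ᵛ c)))
      ; independent = λ c c≈0 → let eq = ≈ᴹ-trans (≈ᴹ-sym (linearCombination-adjoin c)) c≈0 in
          λ { zero → proj₂ eq ; (Fin.suc i) → independent (c ∘ Fin.suc) (proj₁ eq) i }
      }
      where open IsBasis isBasis

  0<d*z² : ∀ z → z ≢ 0ℤ → 0ℤ ℤ.< +[1+ d ] * (z * z)
  0<d*z² (+ ℕ.zero) z≢0 = contradiction refl z≢0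
  0<d*z² +[1+ _ ]   _   = +<+ z<s
  0<d*z² -[1+ _ ]   _   = +<+ z<s

  -- Only the integer coordinate `z` is tested. If it is zero, `x` must be nonzero and contributes
  -- strictly; otherwise the new summand does.
  B-positiveDefinite : ∀ x → ¬ (x ≈ᴹ 0ᴹ) → 0ℤ ℤ.< B x x
  B-positiveDefinite (x , z) xz≉0 with z ℤ.≟ 0ℤ
  ... | yes refl = ℤ.+-mono-<-≤ (L.positiveDefinite x λ x≈0 → xz≉0 (x≈0 , refl))
    (ℤ.≤-reflexive (sym (ℤ.*-zeroʳ +[1+ d ])))
  ... | no  z≢0  = ℤ.+-mono-≤-< (Q-nonNegative L x) (0<d*z² z z≢0)

  lattice : ℤ-Lattice
  lattice = record
    { ℤ-module           = M
    ; isFreeOfFiniteRank = record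
      { rank    = ℕ.suc rank
      ; basis   = adjoinBasis basis
      ; isBasis = adjoinBasis-isBasis basis isBasis
      }
    ; B                  = B
    ; isBilinear         = record
      { cong    = λ (x≈ , z≡) (y≈ , w≡) →
          cong₂ _+_ (B.cong x≈ y≈) (cong (+[1+ d ] *_) (cong₂ _*_ z≡ w≡))
      ; +-homoˡ = λ (x , z) (x′ , z′) (y , w) →
          trans (cong (ℤ._+ _) (B.+-homoˡ x x′ y)) (distˡ (L.B x y) (L.B x′ y) +[1+ d ] z z′ w)
      ; +-homoʳ = λ (x , z) (y , w) (y′ , w′) →
          trans (cong (ℤ._+ _) (B.+-homoʳ x y y′)) (distʳ (L.B x y) (L.B x y′) +[1+ d ] z w w′)
      ; *-homoˡ = λ k (x , z) (y , w) →
          trans (cong (ℤ._+ _) (B.*-homoˡ k x y)) (scaleˡ k (L.B x y) +[1+ d ] z w)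
      ; *-homoʳ = λ k (x , z) (y , w) →
          trans (cong (ℤ._+ _) (B.*-homoʳ k x y)) (scaleʳ k (L.B x y) +[1+ d ] z w)
      }
    ; symmetric          = λ (x , z) (y , w) →
        cong₂ _+_ (L.symmetric x y) (cong (+[1+ d ] *_) (ℤ.*-comm z w))
    ; positiveDefinite   = B-positiveDefinite
    }
    where
    open IsFreeOfFiniteRank isFreeOfFiniteRank

    distˡ : ∀ b b′ d z z′ w → (b + b′) + d * ((z + z′) * w) ≡
      (b + d * (z * w)) + (b′ + d * (z′ * w))
    distˡ = solve-∀

    distʳ : ∀ b b′ d z w w′ → (b + b′) + d * (z * (w + w′)) ≡
      (b + d * (z * w)) + (b′ + d * (z * w′))
    distʳ = solve-∀

    scaleˡ : ∀ k b d z w → k * b + d * ((k * z) * w) ≡ k * (b + d * (z * w))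
    scaleˡ = solve-∀

    scaleʳ : ∀ k b d z w → k * b + d * (z * (k * w)) ≡ k * (b + d * (z * w))
    scaleʳ = solve-∀

-- The coefficients are shifted by one to be positive: this is
-- L ⊥ ⟨1 + d₁⟩ ⊥ … ⊥ ⟨1 + dₖ⟩.
_⊥⟨1+_⟩ : ℤ-Lattice → List ℕ → ℤ-Lattice
L ⊥⟨1+ ds ⟩ = foldr (flip Adjoin.lattice) L ds

represents-⊥ : ∀ L {n} ds → Represents L n → Represents (L ⊥⟨1+ ds ⟩) n
represents-⊥ L []       r = r
represents-⊥ L (d ∷ ds) r with x , n≡Qx ← represents-⊥ L ds r =
  (x , 0ℤ) , trans n≡Qx (sym (x+d*0≡x _ +[1+ d ]))

represents-coefficient : ∀ L {d ds} → d ∈ˡ ds → Represents (L ⊥⟨1+ ds ⟩) (ℕ.suc d)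
represents-coefficient L {d} {_ ∷ ds} (here refl)
  with x , 0≡Qx ← represents-zero (L ⊥⟨1+ ds ⟩) =
  (x , 1ℤ) , cong₂ _+_ 0≡Qx (sym (ℤ.*-identityʳ +[1+ d ]))
represents-coefficient L {ds = d′ ∷ ds} (there d∈ds) =
  represents-⊥ (L ⊥⟨1+ ds ⟩) (d′ ∷ []) (represents-coefficient L d∈ds)

-- A nonzero coordinate along `⟨1 + d⟩` contributes at least `1 + d > n`, while the rest is
-- nonnegative. Hence every new coordinate vanishes.
represents-⊥⁻ : ∀ L {n} ds → All (n ≤_) ds → Represents (L ⊥⟨1+ ds ⟩) n → Represents L n
represents-⊥⁻ L []       []           r = r
represents-⊥⁻ L {n} (d ∷ ds) (n≤d ∷ n≤ds) ((x , z) , n≡Q) =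
  represents-⊥⁻ L ds n≤ds (x , n≡Qx z n≡Q)
  where
  open ℤ-Lattice (L ⊥⟨1+ ds ⟩)

  -- Here `1 + m` stands for `z * z` with `z` of either sign.
  large : ∀ m → + n ≢ Q x + +[1+ d ] * +[1+ m ]
  large m = ℤ.<⇒≢ $ begin-strict
    + n                       ≤⟨ ℤ.+≤+ n≤d ⟩
    + d                       <⟨ +<+ (ℕ.n<1+n d) ⟩
    +[1+ d ]                  ≤⟨ ℤ.+≤+ (ℕ.m≤m*n (ℕ.suc d) (ℕ.suc m)) ⟩
    +[1+ d ] * +[1+ m ]       ≡⟨ ℤ.+-identityˡ _ ⟨
    0ℤ + +[1+ d ] * +[1+ m ]  ≤⟨ ℤ.+-monoˡ-≤ _ (Q-nonNegative (L ⊥⟨1+ ds ⟩) x) ⟩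
    Q x + +[1+ d ] * +[1+ m ] ∎
    where open ℤ.≤-Reasoning

  n≡Qx : ∀ z → + n ≡ Q x + +[1+ d ] * (z * z) → + n ≡ Q x
  n≡Qx (+ ℕ.zero) n≡ = trans n≡ (x+d*0≡x (Q x) +[1+ d ])
  n≡Qx +[1+ _ ]   n≡ = contradiction n≡ (large _)
  n≡Qx -[1+ _ ]   n≡ = contradiction n≡ (large _)

-- Four copies of `⟨1 + d⟩` represent every multiple of `1 + d`, by Lagrange's theorem.
represents-⊥-multiple : ∀ L {n} d q → Represents L n →
  Represents (L ⊥⟨1+ d ∷ d ∷ d ∷ d ∷ [] ⟩) (n ℕ.+ ℕ.suc d ℕ.* q)
represents-⊥-multiple L {n} d q (x , n≡Qx) =
  let (z₁ , z₂ , z₃ , z₄) , z≡q = lagrange q in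
  ((((x , z₁) , z₂) , z₃) , z₄) , (begin
    + (n ℕ.+ ℕ.suc d ℕ.* q)                   ≡⟨ cong (ℤ._+_ (+ n)) (ℤ.pos-* (ℕ.suc d) q) ⟩
    + n + +[1+ d ] * + q                      ≡⟨ cong₂ (λ m r → m + +[1+ d ] * r) n≡Qx (sym z≡q) ⟩
    Q x + +[1+ d ] * norm (z₁ , z₂ , z₃ , z₄) ≡⟨ distrib (Q x) +[1+ d ] z₁ z₂ z₃ z₄ ⟩
    _                                         ∎)
  where
  open ℤ-Lattice L using (Q)
  open ≡-Reasoning

  distrib : ∀ n d z₁ z₂ z₃ z₄ → n + d * (z₁ * z₁ + z₂ * z₂ + z₃ * z₃ + z₄ * z₄) ≡
    n + d * (z₁ * z₁) + d * (z₂ * z₂) + d * (z₃ * z₃) + d * (z₄ * z₄)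
  distrib = solve-∀

-- Representing everything above a given number

module _ (L : ℤ-Lattice) (a : ℕ) where

  private
    -- After the shift by one these are `a + 1` up to `2a + 1`, one for each residue modulo `a + 1`.
    coefficients : List ℕ
    coefficients = map (a ℕ.+_) (upTo (ℕ.suc a))

    above : ℤ-Lattice
    above = L ⊥⟨1+ coefficients ⟩

  representAbove : ℤ-Lattice
  representAbove = above ⊥⟨1+ a ∷ a ∷ a ∷ a ∷ [] ⟩

  representAbove-extends : ∀ {n} → Represents L n → Represents representAbove n
  representAbove-extends = represents-⊥ above (a ∷ a ∷ a ∷ a ∷ []) ∘ represents-⊥ L coefficients

  representAbove-above : ∀ {n} → a < n → Represents representAbove n
  representAbove-above {n} a<n = subst (Represents representAbove) n≡
    (represents-⊥-multiple above a q (represents-coefficient L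
      (∈-map⁺ (a ℕ.+_) (∈-upTo⁺ (ℕ.m%n<n m (ℕ.suc a))))))
    where
    -- Taking away `a + 1` before dividing leaves `a + 1 + r`, which is an available coefficient;
    -- the bare remainder `r` would not be.
    m = n ℕ.∸ ℕ.suc a
    q = m ℕ./ ℕ.suc a
    r = m ℕ.% ℕ.suc a

    n≡ : ℕ.suc (a ℕ.+ r) ℕ.+ ℕ.suc a ℕ.* q ≡ n
    n≡ = begin
      ℕ.suc a ℕ.+ r ℕ.+ ℕ.suc a ℕ.* q   ≡⟨ ℕ.+-assoc (ℕ.suc a) r _ ⟩
      ℕ.suc a ℕ.+ (r ℕ.+ ℕ.suc a ℕ.* q) ≡⟨ cong (λ t → ℕ.suc a ℕ.+ (r ℕ.+ t))
                                             (ℕ.*-comm (ℕ.suc a) q) ⟩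
      ℕ.suc a ℕ.+ (r ℕ.+ q ℕ.* ℕ.suc a) ≡⟨ cong (ℕ.suc a ℕ.+_) (ℕ.m≡m%n+[m/n]*n m (ℕ.suc a)) ⟨
      ℕ.suc a ℕ.+ m                     ≡⟨ ℕ.m+[n∸m]≡n a<n ⟩
      n                                 ∎
      where open ≡-Reasoning

  representAbove-reflects : Represents representAbove a → Represents L a
  representAbove-reflects =
    represents-⊥⁻ L coefficients (tabulate λ d∈ → let r , _ , d≡a+r = ∈-map⁻ (a ℕ.+_) d∈ in
      subst (a ≤_) (sym d≡a+r) (ℕ.m≤m+n a r)) ∘
    represents-⊥⁻ above (a ∷ a ∷ a ∷ a ∷ []) (ℕ.≤-refl ∷ ℕ.≤-refl ∷ ℕ.≤-refl ∷ ℕ.≤-refl ∷ [])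

-- Truants

module _ (S : Pred ℕ 0ℓ) where

  IsTruant : ℕ → Set (suc 0ℓ)
  IsTruant a = a ∈ S × ∃ λ L →
    (∀ {b} → b ∈ S → b < a → Represents L b) × ¬ Represents L a

  -- Strengthens "below `a`" to "other than `a`": smaller elements are inherited from the truant's
  -- lattice, larger ones come from the adjoined summands.
  exception : ∀ {a} → IsTruant a → ∃ λ L →
    (∀ {b} → b ∈ S → b ≢ a → Represents L b) × ¬ Represents L a
  exception {a} (_ , L , below , a∉L) =
    representAbove L a , others , a∉L ∘ representAbove-reflects L a
    where
    others : ∀ {b} → b ∈ S → b ≢ a → Represents (representAbove L a) b
    others {b} b∈S b≢a with ℕ.<-cmp b a
    ... | tri< b<a _ _ = representAbove-extends L a (below b∈S b<a)
    ... | tri≈ _ b≡a _ = contradiction b≡a b≢a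
    ... | tri> _ _ a<b = representAbove-above L a a<b

  module _ (em : ExcludedMiddle (suc 0ℓ)) where

    private
      em₀ : ExcludedMiddle 0ℓ
      em₀ = map′ lower (lift {ℓ = suc 0ℓ}) em

    -- IsTruant lives in Set₁; its decision brings it down to Set.
    Truants : Pred ℕ 0ℓ
    Truants a = True (em {IsTruant a})

    -- If `a ∉ T`, the lattice of `exception` would represent all of `T`, hence all of `S`, hence
    -- `a` itself.
    truants⊆criterionSet : ∀ {T} → IsCriterionSet S T → Truants ⊆ T
    truants⊆criterionSet {T} (T⊆S , criterion) {a} a∈Truants
      with truant ← toWitness a∈Truants
      with L , others , a∉L ← exception truant =
      decidable-stable em₀ λ a∉T → a∉L (criterion L
        (λ b∈T → others (T⊆S b∈T) λ b≡a → a∉T (subst T b≡a b∈T))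
        (proj₁ truant))

    -- Strong induction on `a`: if `L` represents every smaller element of `S` but not `a`, then `L`
    -- itself certifies `a` as a truant, which `L` represents by assumption.
    truants-isCriterionSet : IsCriterionSet S Truants
    truants-isCriterionSet = proj₁ ∘ toWitness , λ L universal {a} →
      <-rec (λ a → a ∈ S → Represents L a)
        (λ a rec a∈S → decidable-stable em₀ λ a∉L →
          a∉L (universal (fromWitness (a∈S , L , (λ {b} b∈S b<a → rec {b} b<a b∈S) , a∉L))))
        a

    truants-isMinimalCriterionSet : IsMinimalCriterionSet S Truants
    truants-isMinimalCriterionSet = truants-isCriterionSet ,
      λ T (_ , Truants⊈T) T-criterion → Truants⊈T (truants⊆criterionSet T-criterion)

    truants-unique : ∀ {T} → IsMinimalCriterionSet S T → Truants ≐ T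
    -- Were the inclusion of `Truants` in `T` proper, `Truants` would be a criterion set violating
    -- the minimality of `T`.
    truants-unique (T-criterion , T-minimal) = truants⊆T , decidable-stable em₀ λ T⊈Truants →
      T-minimal Truants (truants⊆T , T⊈Truants) truants-isCriterionSet
      where truants⊆T = truants⊆criterionSet T-criterion

theorem2p2 : ExcludedMiddle (suc 0ℓ) →
    (S : Pred ℕ 0ℓ) → S ⊆ (0 <_) → ∃! _≐_ (IsMinimalCriterionSet S)
theorem2p2 em S _ = Truants S em , truants-isMinimalCriterionSet S em , truants-unique S em
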